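{- Let $G$ be a (possibly infinite) graph and $k$ a positive integer such that $G$ contains no path on $k$ vertices as a subgraph and every vertex of $G$ lies on fewer than $k$ pairwise edge-disjoint cycles. Then, whatever the cat's starting vertex and play, the herder can capture the cat after at most $k^3-2k^2+3k-2$ edge deletions; i.e. $\mathrm{cat}(G)\le k^3-2k^2+3k-2$.
   Context: Cat Herding is played on a simple, possibly infinite graph $G$. The cat first places its token on a vertex. Then the players alternate, the herder moving first: the herder deletes one edge of the current graph, and then, unless the cat's current vertex has degree $0$ in the current graph, the cat moves its token along a finite path with at least one edge in the current graph to a different vertex. The cat is captured when its vertex has degree $0$ in the current graph; the score is the number of edges deleted. $\mathrm{cat}(G)$ denotes the optimal score (herder minimizing, cat maximizing, cat choosing the start). -}

module Defs where

open import Data.List using (List; []; _∷_; _∷ʳ_; length; zip; drop)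
open import Data.List.Membership.Propositional using (_∈_)
open import Data.List.Relation.Unary.All using (All)
open import Data.List.Relation.Unary.AllPairs using (AllPairs)
open import Data.List.Relation.Unary.Linked using (Linked)
open import Data.List.Relation.Unary.Unique.Propositional using (Unique)
open import Data.Nat using (ℕ; suc; _≤_; _<_)
open import Data.Product using (_×_; _,_; ∃)
open import Data.Sum using (_⊎_; inj₁; inj₂)
open import Level using (Level) renaming (suc to lsuc)
open import Relation.Binary.PropositionalEquality using (_≡_; _≢_)
open import Relation.Nullary using (¬_)

private
  variable
    ℓ : Level

-- Simple graphs, with no finiteness assumption.  Adj is allowed to be
-- proof-relevant, but an edge is just an unordered pair of adjacent
-- vertices: different proofs of Adj x y do not count as parallel edges.
record Graph (V : Set ℓ) : Set (lsuc ℓ) where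
  field
    Adj    : V → V → Set ℓ
    sym    : ∀ {x y} → Adj x y → Adj y x
    irrefl : ∀ {x} → ¬ Adj x x

open Graph public using (Adj)

SameEdge : {V : Set ℓ} → V → V → V → V → Set ℓ
SameEdge x y u w = (x ≡ u × y ≡ w) ⊎ (x ≡ w × y ≡ u)

deleteEdge : {V : Set ℓ} → Graph V → V → V → Graph V
deleteEdge G u w = record
  { Adj    = λ x y → Adj G x y × ¬ SameEdge x y u w
  ; sym    = λ (xy , xy≢uw) → Graph.sym G xy , λ yx≡uw → xy≢uw (flip yx≡uw)
  ; irrefl = λ (xx , _) → Graph.irrefl G xx
  }
  where
  flip : ∀ {x y} → SameEdge y x u w → SameEdge x y u w
  flip (inj₁ (y≡u , x≡w)) = inj₂ (x≡w , y≡u)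
  flip (inj₂ (y≡w , x≡u)) = inj₁ (x≡u , y≡w)

-- The list of vertices, in order, of a path subgraph (not necessarily
-- induced).
IsPath : {V : Set ℓ} → Graph V → List V → Set ℓ
IsPath G xs = Linked (Adj G) xs × Unique xs

NoPathOn : {V : Set ℓ} → ℕ → Graph V → Set ℓ
NoPathOn k G = ∀ xs → IsPath G xs → length xs ≢ k

-- A cycle, presented by its vertices in cyclic order from some base point.
record Cycle {V : Set ℓ} (G : Graph V) : Set ℓ where
  field
    base     : V
    rest     : List V
    distinct : Unique (base ∷ rest)
    linked   : Linked (Adj G) (base ∷ rest ∷ʳ base)
    length≥3 : 3 ≤ length (base ∷ rest)

  vertices : List V
  vertices = base ∷ rest

  closedWalk : List V
  closedWalk = base ∷ rest ∷ʳ base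

  -- The edge {u , w} is on the cycle, traversed in one direction or the other.
  HasEdge : V → V → Set ℓ
  HasEdge u w = (u , w) ∈ steps ⊎ (w , u) ∈ steps
    where
    steps : List (V × V)
    steps = zip closedWalk (drop 1 closedWalk)

EdgeDisjoint : {V : Set ℓ} {G : Graph V} → Cycle G → Cycle G → Set ℓ
EdgeDisjoint c d = ∀ u w → Cycle.HasEdge c u w → ¬ Cycle.HasEdge d u w

-- Finite families suffice here: an infinite family of pairwise edge-disjoint
-- cycles through v would contain finite ones of every size.
FewerEdgeDisjointCyclesThan : {V : Set ℓ} → ℕ → Graph V → V → Set ℓ
FewerEdgeDisjointCyclesThan k G v =
  (cs : List (Cycle G)) →
  All (λ c → v ∈ Cycle.vertices c) cs →
  AllPairs EdgeDisjoint cs →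
  length cs < k

Captured : {V : Set ℓ} → Graph V → V → Set ℓ
Captured G v = ∀ w → ¬ Adj G v w

-- A path from v to w; it has at least one edge, and v ≢ w since the
-- vertices of a path are distinct.
CatMove : {V : Set ℓ} → Graph V → V → V → Set ℓ
CatMove G v w = ∃ λ xs → IsPath G (v ∷ xs ∷ʳ w)

-- HerderCaptures G n v: with the cat on v and the herder to move in G, the
-- herder has a strategy capturing the cat after at most n further deletions.
-- If deleting {u , w} isolates the cat's vertex then there is no CatMove, so
-- the last premise of delete holds vacuously and the game is over.
data HerderCaptures {V : Set ℓ} (G : Graph V) : ℕ → V → Set ℓ where
  captured : ∀ {n v} → Captured G v → HerderCaptures G n v
  delete   : ∀ {n v} u w → Adj G u w →
             (∀ x → CatMove (deleteEdge G u w) v x →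
                    HerderCaptures (deleteEdge G u w) n x) →
             HerderCaptures G (suc n) v

-- c is the value cat(G) of the game: the least score that the herder can
-- guarantee not to exceed, whichever start vertex the cat chooses.
record IsCatNumber {V : Set ℓ} (G : Graph V) (c : ℕ) : Set ℓ where
  field
    guarantee : ∀ v → HerderCaptures G c v
    optimal   : ∀ m → (∀ v → HerderCaptures G m v) → c ≤ m

{-# OPTIONS --safe #-}

-- Fix a target v. At most k - 1 times, the herder deletes all (at most k - 1)
-- edges of a cycle through v; then v lies on no cycle, and two more deletions
-- separate the cat from v. The cat's new component is joined, in the graph
-- before these deletions, to v by a path that meets it only at its last
-- vertex, which becomes the new target. The successive targets lie on a
-- growing path of G that the cat can never reach again, so after at most k - 1
-- rounds, each of (k - 1)² + 2 deletions, the path would have k vertices.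
module Submission where

open import Defs
open import Axiom.ExcludedMiddle using (ExcludedMiddle)
open import Data.Nat using (ℕ; zero; suc; _+_; _*_; _∸_; _^_; _≤_; _<_; z≤n; s≤s; s≤s⁻¹)
open import Data.Nat.Properties
open import Data.Nat.Tactic.RingSolver using (solve-∀)
open import Data.List using (List; []; _∷_; _∷ʳ_; length; map; zip; drop; take)
open import Data.List.Properties using (length-map; length-zipWith; length-take)
open import Data.List.Membership.Propositional using (_∈_; _∉_)
open import Data.List.Relation.Unary.All as All using (All; []; _∷_)
import Data.List.Relation.Unary.All.Properties as All
open import Data.List.Relation.Unary.AllPairs using ([]; _∷_)
import Data.List.Relation.Unary.AllPairs.Properties as AllPairs
open import Data.List.Relation.Unary.Any using (here; there)
open import Data.List.Relation.Unary.Linked as Linked using (Linked; []; [-]; _∷_)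
import Data.List.Relation.Unary.Unique.Propositional.Properties as Unique
open import Data.Product using (_×_; _,_; ∃; ∃₂; proj₁; proj₂)
open import Data.Sum using (_⊎_; inj₁; inj₂)
import Level
open import Function using (_∘_; id)
open import Relation.Binary.Core using (Rel; _⇒_)
open import Relation.Binary.Construct.Closure.ReflexiveTransitive as Star
  using (Star; ε; _◅_; _◅◅_)
open import Relation.Binary.PropositionalEquality
  using (_≡_; _≢_; refl; sym; trans; cong; subst)
open import Relation.Nullary using (Dec; ¬_; yes; no; contradiction)

-- Walks as linked lists.

module _ {a r} {A : Set a} {R : Rel A r} where

  linked-take : ∀ n {xs} → Linked R xs → Linked R (take n xs)
  linked-take zero          _        = []
  linked-take (suc n)       []       = []
  linked-take (suc n)       [-]      = subst (Linked R ∘ (_ ∷_)) (sym (take-[] n)) [-]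
    where
    take-[] : ∀ n → take n [] ≡ ([] {A = A})
    take-[] zero    = refl
    take-[] (suc _) = refl
  linked-take (suc zero)    (r ∷ rs) = [-]
  linked-take (suc (suc n)) (r ∷ rs) = r ∷ linked-take (suc n) rs

  linked-∷ʳ⁺ : ∀ xs {y z} → Linked R (xs ∷ʳ y) → R y z → Linked R (xs ∷ʳ y ∷ʳ z)
  linked-∷ʳ⁺ []           _        ryz = ryz ∷ [-]
  linked-∷ʳ⁺ (_ ∷ [])     (r ∷ rs) ryz = r ∷ linked-∷ʳ⁺ [] rs ryz
  linked-∷ʳ⁺ (_ ∷ x ∷ xs) (r ∷ rs) ryz = r ∷ linked-∷ʳ⁺ (x ∷ xs) rs ryz

  linked-init : ∀ xs {y} → Linked R (xs ∷ʳ y) → Linked R xs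
  linked-init []           _        = []
  linked-init (_ ∷ [])     _        = [-]
  linked-init (_ ∷ x ∷ xs) (r ∷ rs) = r ∷ linked-init (x ∷ xs) rs

  linked-step : ∀ {xs u w} → Linked R xs → (u , w) ∈ zip xs (drop 1 xs) → R u w
  linked-step (r ∷ _)  (here refl) = r
  linked-step (_ ∷ rs) (there p)   = linked-step rs p

  linked⇒star : ∀ {x y xs} → Linked R (x ∷ xs) → y ∈ x ∷ xs → Star R x y
  linked⇒star _        (here refl) = ε
  linked⇒star (r ∷ rs) (there p) = r ◅ linked⇒star rs p

module _ {a} {A : Set a} where

  last-∈ : ∀ xs {y : A} → y ∈ xs ∷ʳ y
  last-∈ []       = here refl
  last-∈ (_ ∷ xs) = there (last-∈ xs)

  length-∷ʳ : ∀ xs {y : A} → length (xs ∷ʳ y) ≡ suc (length xs)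
  length-∷ʳ []       = refl
  length-∷ʳ (_ ∷ xs) = cong suc (length-∷ʳ xs)

-- Subgraphs, reachability and cycles.

module _ {ℓ} {V : Set ℓ} where

  Subgraph : Graph V → Graph V → Set ℓ
  Subgraph H K = Adj H ⇒ Adj K

  Reach : Graph V → V → V → Set ℓ
  Reach H = Star (Adj H)

  reach-sym : ∀ (H : Graph V) {x y} → Reach H x y → Reach H y x
  reach-sym H = Star.reverse (Graph.sym H)

  move⇒reach : ∀ (H : Graph V) {x y} → CatMove H x y → Reach H x y
  move⇒reach H {x} (xs , linked , _) = linked⇒star linked (there (last-∈ xs))

  move⇒≢ : ∀ (H : Graph V) {x y} → CatMove H x y → x ≢ y
  move⇒≢ H (xs , _ , x∉ ∷ _) = All.lookup x∉ (last-∈ xs)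

  first-step : ∀ (H : Graph V) {x y} → CatMove H x y →
               ∃₂ λ (w : V) (zs : List V) → IsPath H (x ∷ w ∷ zs) × y ∈ w ∷ zs
  first-step H ([]     , path) = _ , _ , path , here refl
  first-step H (w ∷ xs , path) = w , _ , path , there (last-∈ xs)

  -- `NoPathOn` forbids exactly `k` vertices; a longer path would have an initial segment of that
  -- size.
  no-long-path : ∀ (G : Graph V) {k} → NoPathOn k G → ∀ xs → IsPath G xs → length xs < k
  no-long-path G {k} none xs (linked , unique) =
    ≰⇒> λ k≤ → none (take k xs) (linked-take k linked , Unique.take⁺ k unique)
                    (trans (length-take k xs) (m≤n⇒m⊓n≡m k≤))

  cycle-mono : ∀ {H K : Graph V} → Subgraph H K → Cycle H → Cycle K
  cycle-mono H⊆K c = record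
    { base     = base
    ; rest     = rest
    ; distinct = distinct
    ; linked   = Linked.map H⊆K linked
    ; length≥3 = length≥3
    }
    where open Cycle c

  steps : ∀ {H : Graph V} → Cycle H → List (V × V)
  steps c = zip closedWalk (drop 1 closedWalk)
    where open Cycle c

  length-steps : ∀ {H : Graph V} (c : Cycle H) → length (steps c) ≤ length (Cycle.vertices c)
  length-steps c = begin
    length (steps c)         ≡⟨ length-zipWith _,_ (base ∷ rest ∷ʳ base) (rest ∷ʳ base) ⟩
    _                        ≤⟨ m⊓n≤n _ (length (rest ∷ʳ base)) ⟩
    length (rest ∷ʳ base)    ≡⟨ length-∷ʳ rest ⟩
    length (base ∷ rest)     ∎
    where
    open Cycle c
    open ≤-Reasoning

  hasEdge⇒adj : ∀ (H : Graph V) (c : Cycle H) {u w} → Cycle.HasEdge c u w → Adj H u w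
  hasEdge⇒adj H c (inj₁ p) = linked-step (Cycle.linked c) p
  hasEdge⇒adj H c (inj₂ p) = Graph.sym H (linked-step (Cycle.linked c) p)

  -- Dropping the closing edge turns a cycle into a path on the same vertices.
  cycle-short : ∀ (G : Graph V) {k} → NoPathOn (suc k) G →
                (c : Cycle G) → length (Cycle.vertices c) ≤ k
  cycle-short G none c =
    s≤s⁻¹ (no-long-path G none vertices (linked-init vertices linked , distinct))
    where open Cycle c

  fewer-mono : ∀ {H K : Graph V} {k v} → Subgraph H K →
               FewerEdgeDisjointCyclesThan k K v → FewerEdgeDisjointCyclesThan k H v
  fewer-mono {k = k} H⊆K fewer cs through disjoint =
    subst (_< k) (length-map (cycle-mono H⊆K) cs)
      (fewer (map (cycle-mono H⊆K) cs) (All.map⁺ through) (AllPairs.map⁺ disjoint))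

  -- `c` shares no edge with any cycle of `H`, so it enlarges every edge-disjoint family through `v`
  -- in `H` by one.
  fewer-without : ∀ {H K : Graph V} {k v} → Subgraph H K → (c : Cycle K) → v ∈ Cycle.vertices c →
                  (∀ u w → Cycle.HasEdge c u w → ¬ Adj H u w) →
                  FewerEdgeDisjointCyclesThan (suc k) K v →
                  FewerEdgeDisjointCyclesThan k H v
  fewer-without {H} {k = k} H⊆K c v∈c removed fewer cs through disjoint =
    s≤s⁻¹ (subst (λ n → suc n < suc k) (length-map (cycle-mono H⊆K) cs)
      (fewer (c ∷ map (cycle-mono H⊆K) cs)
             (v∈c ∷ All.map⁺ through)
             (All.map⁺ (All.universal
                (λ d u w c∋uw d∋uw → removed u w c∋uw (hasEdge⇒adj H d d∋uw)) cs)
              ∷ AllPairs.map⁺ disjoint)))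

  Acyclic : Graph V → V → Set ℓ
  Acyclic H v = (c : Cycle H) → v ∉ Cycle.vertices c

  acyclic-mono : ∀ {H K : Graph V} {v} → Subgraph H K → Acyclic K v → Acyclic H v
  acyclic-mono H⊆K acyclic c = acyclic (cycle-mono H⊆K c)

  weaken : ∀ {H : Graph V} {m n v} → m ≤ n → HerderCaptures H m v → HerderCaptures H n v
  weaken _         (captured done)  = captured done
  weaken (s≤s m≤n) (delete u w e s) = delete u w e λ x mv → weaken m≤n (s x mv)

  avoiding : ∀ (H : Graph V) {v w xs} → Linked (Adj H) xs → All (v ≢_) xs →
             Linked (Adj (deleteEdge H v w)) xs
  avoiding H []       _                     = []
  avoiding H [-]      _                     = [-]
  avoiding H (e ∷ es) (v≢x ∷ v≢s@(v≢y ∷ _)) =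
    (e , λ { (inj₁ (x≡v , _)) → v≢x (sym x≡v) ; (inj₂ (_ , y≡v)) → v≢y (sym y≡v) })
    ∷ avoiding H es v≢s

  -- The path `zs` is followed from `v`, each vertex being pushed onto the front of `v ∷ p`, until
  -- it first meets `C`; `y` ensures that it does. Stopping at the first hit keeps the tail outside
  -- `C`.
  extend-until : ∀ (G H : Graph V) → Subgraph H G → (C : V → Set ℓ) → ExcludedMiddle ℓ →
                 ∀ {v y p} zs → IsPath H (v ∷ zs) → y ∈ zs → C y →
                 IsPath G (v ∷ p) → (∀ {z} → z ∈ zs → z ∉ p) → (∀ {z} → z ∈ v ∷ p → ¬ C z) →
                 ∃₂ λ (b : V) (q : List V) → IsPath G (b ∷ q) × length p < length q ×
                   C b × (∀ {z} → z ∈ q → ¬ C z)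
  extend-until G H H⊆G C em {v} {p = p} (b ∷ zs) (e ∷ es , (v≢b ∷ v∉zs) ∷ unique′) y∈ Cy
               (linked , unique) fresh outside = go em y∈
    where
    path : IsPath G (b ∷ v ∷ p)
    path = Graph.sym G (H⊆G e) ∷ linked ,
           ((v≢b ∘ sym) ∷ All.¬Any⇒All¬ p (fresh (here refl))) ∷ unique

    go : Dec (C b) → _ ∈ b ∷ zs →
         ∃₂ λ (c : V) (q : List V) →
         IsPath G (c ∷ q) × length p < length q × C c × (∀ {z} → z ∈ q → ¬ C z)
    go (yes Cb) _           = b , v ∷ p , path , ≤-refl , Cb , outside
    go (no ¬Cb) (here refl) = contradiction Cy ¬Cb
    go (no ¬Cb) (there y∈)  =
      let c , q , path′ , longer , rest =
            extend-until G H H⊆G C em zs (es , unique′) y∈ Cy path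
              (λ { z∈ (here refl) → All.lookup v∉zs z∈ refl
                 ; z∈ (there z∈p) → fresh (there z∈) z∈p })
              (λ { (here refl) → ¬Cb ; (there z∈) → outside z∈ })
      in c , q , path′ , <-trans (n<1+n _) longer , rest

  -- Paths, bridges and the phases of a round.

  module _ (em : ExcludedMiddle ℓ) where

    suffix : ∀ (H : Graph V) {x y} zs → IsPath H (zs ∷ʳ y) → x ∈ zs ∷ʳ y →
             x ≡ y ⊎ CatMove H x y
    suffix H []       _                 (here x≡y)  = inj₁ x≡y
    suffix H (_ ∷ zs) path              (here refl) = inj₂ (zs , path)
    suffix H (_ ∷ zs) (es , _ ∷ unique) (there x∈)  = suffix H zs (Linked.tail es , unique) x∈

    -- Induction along the walk: a new first vertex either extends the path or lies on it already,
    -- and then `suffix` cuts off the loop.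
    reach⇒move : ∀ (H : Graph V) {x y} → Reach H x y → x ≡ y ⊎ CatMove H x y
    reach⇒move H ε = inj₁ refl
    reach⇒move H {x} {y} (e ◅ es) = extend (reach⇒move H es) e
      where
      extend : ∀ {z} → z ≡ y ⊎ CatMove H z y → Adj H x z → x ≡ y ⊎ CatMove H x y
      extend (inj₁ refl) e = inj₂ ([] , e ∷ [-] , ((λ { refl → Graph.irrefl H e }) ∷ []) ∷ [] ∷ [])
      extend {z} (inj₂ (zs , linked , unique)) e with em {x ∈ z ∷ zs ∷ʳ y}
      ... | yes x∈ = suffix H (z ∷ zs) (linked , unique) x∈
      ... | no  x∉ = inj₂ (z ∷ zs , e ∷ linked , All.¬Any⇒All¬ _ x∉ ∷ unique)

    -- A path from `v` to `w` without the edge between them would close up with that edge to a cycle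
    -- through `v`. A path of one edge would be the deleted edge itself.
    acyclic⇒bridge : ∀ (H : Graph V) {v w} → Acyclic H v → Adj H v w →
                     ¬ Reach (deleteEdge H v w) v w
    acyclic⇒bridge H {v} {w} acyclic e v~w with reach⇒move (deleteEdge H v w) v~w
    ... | inj₁ refl                  = Graph.irrefl H e
    ... | inj₂ ([] , e′ ∷ _ , _)     = proj₂ e′ (inj₁ (refl , refl))
    ... | inj₂ (x ∷ xs , linked , unique) = acyclic cycle (here refl)
      where
      cycle : Cycle H
      cycle = record
        { base     = v
        ; rest     = x ∷ xs ∷ʳ w
        ; distinct = unique
        ; linked   = linked-∷ʳ⁺ (v ∷ x ∷ xs) (Linked.map proj₁ linked) (Graph.sym H e)
        ; length≥3 = s≤s (s≤s (subst (1 ≤_) (sym (length-∷ʳ xs)) (s≤s z≤n)))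
        }

    -- Phases of the strategy are chained in continuation-passing style: `P` is what a phase
    -- achieves and `n` the budget left after it. Reachability in the earlier graph `H` records that
    -- the cat never leaves its component.
    Continuation : (H : Graph V) (n : ℕ) (x : V) (P : Graph V → V → Set ℓ) → Set (Level.suc ℓ)
    Continuation H n x P =
      ∀ H′ y → Subgraph H′ H → Reach H x y → P H′ y → HerderCaptures H′ n y

    after-move : ∀ (H : Graph V) u w {n x y P} → CatMove (deleteEdge H u w) x y →
                 Continuation H n x P → Continuation (deleteEdge H u w) n y P
    after-move H u w mv k H′ z sub y~z =
      k H′ z (proj₁ ∘ sub) (Star.map proj₁ (move⇒reach (deleteEdge H u w) mv ◅◅ y~z))

    delete-all : ∀ es (H : Graph V) {n x} →
                 Continuation H n x (λ H′ _ → ∀ {u w} → (u , w) ∈ es → ¬ Adj H′ u w) →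
                 HerderCaptures H (length es + n) x
    delete-all [] H k = k H _ id ε λ ()
    -- Only an edge still present can be deleted; an absent one is skipped, and `weaken` absorbs the
    -- saved deletion.
    delete-all ((u , w) ∷ es) H {n} {x} k with em {Adj H u w}
    ... | yes e = delete u w e λ y mv → delete-all es (deleteEdge H u w)
          λ H′ z sub y~z gone → after-move H u w mv k H′ z sub y~z
            λ { (here refl) e′ → proj₂ (sub e′) (inj₁ (refl , refl)) ; (there p) → gone p }
    ... | no ¬e = weaken (n≤1+n _) (delete-all es H
          λ H′ z sub x~z gone → k H′ z sub x~z
            λ { (here refl) e′ → ¬e (sub e′) ; (there p) → gone p })

    -- Induction on `j`: deleting the at most `m` edges of one cycle through `v` lowers the bound on
    -- edge-disjoint cycles there by one.
    break-cycles : ∀ j {m v} (H : Graph V) {n x} → FewerEdgeDisjointCyclesThan (suc j) H v →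
                   (∀ (c : Cycle H) → length (Cycle.vertices c) ≤ m) →
                   Continuation H n x (λ H′ _ → Acyclic H′ v) →
                   HerderCaptures H (j * m + n) x
    break-cycles zero H fewer _ k =
      k H _ id ε λ c v∈c → contradiction (fewer (c ∷ []) (v∈c ∷ []) ([] ∷ [])) (<-irrefl refl)
    break-cycles (suc j) {m} {v} H {n} {x} fewer short k
      with em {∃ λ (c : Cycle H) → v ∈ Cycle.vertices c}
    ... | no ¬cycle = weaken (m≤n+m n _) (k H x id ε λ c v∈c → ¬cycle (c , v∈c))
    ... | yes (c , v∈c) = weaken bound (delete-all (steps c) H λ H′ y sub x~y gone →
          break-cycles j H′
            (fewer-without sub c v∈c
              (λ { u w (inj₁ p) → gone p ; u w (inj₂ p) → gone p ∘ Graph.sym H′ }) fewer)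
            (short ∘ cycle-mono sub)
            λ H″ z sub′ y~z → k H″ z (sub ∘ sub′) (x~y ◅◅ Star.map sub y~z))
      where
      open ≤-Reasoning
      bound : length (steps c) + (j * m + n) ≤ m + j * m + n
      bound = begin
        length (steps c) + (j * m + n) ≤⟨ +-monoˡ-≤ _ (≤-trans (length-steps c) (short c)) ⟩
        m + (j * m + n)                ≡⟨ +-assoc m _ n ⟨
        m + j * m + n                  ∎

    -- The first edge of a path from `v` to the cat is a bridge, as `v` is on no cycle. The rest of
    -- the path misses `v`, so it survives the deletion and keeps the cat on the far side.
    cut-off-elsewhere : ∀ (H : Graph V) {v n x} → Acyclic H v → v ≢ x →
                        Continuation H n x (λ H′ y → ¬ Reach H′ y v) →
                        HerderCaptures H (suc n) x
    cut-off-elsewhere H {v} {n} {x} acyclic v≢x k with em {Reach H v x}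
    ... | no ¬v~x = weaken (n≤1+n n) (k H x id ε (¬v~x ∘ reach-sym H))
    ... | yes v~x with reach⇒move H v~x
    ... | inj₁ v≡x = contradiction v≡x v≢x
    ... | inj₂ mv with first-step H mv
    ... | w , zs , (e ∷ es , v∉ ∷ _) , x∈ = delete v w e λ y mv →
          k H′ y proj₁ (Star.map proj₁ (move⇒reach H′ mv)) λ y~v →
          acyclic⇒bridge H acyclic e
            (reach-sym H′ (w~x ◅◅ move⇒reach H′ mv ◅◅ y~v))
      where
      H′ : Graph V
      H′ = deleteEdge H v w
      w~x : Reach H′ w x
      w~x = linked⇒star (avoiding H es v∉) x∈

    -- The additional deletion pays for a cat sitting on `v`: it must then move to another vertex,
    -- unless it is captured.
    cut-off : ∀ (H : Graph V) {v n x} → Acyclic H v →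
              Continuation H n x (λ H′ y → ¬ Reach H′ y v) →
              HerderCaptures H (suc (suc n)) x
    cut-off H {v} {n} {x} acyclic k with em {v ≡ x}
    ... | no v≢x = weaken (n≤1+n _) (cut-off-elsewhere H acyclic v≢x k)
    ... | yes refl with em {∃ (Adj H v)}
    ... | no isolated = captured λ w e → isolated (w , e)
    ... | yes (w , e) = delete v w e λ y mv →
          cut-off-elsewhere (deleteEdge H v w) (acyclic-mono proj₁ acyclic)
            (move⇒≢ (deleteEdge H v w) mv) (after-move H v w mv k)

    -- The rounds of the pursuit.

    module _ {G : Graph V} {j : ℕ} (none : NoPathOn (suc j) G)
             (fewer : ∀ v → FewerEdgeDisjointCyclesThan (suc j) G v) where

      -- Induction on the number `m` of rounds left. The target `v` lies in the cat's component and
      -- `p` outside it; each round lengthens `p`, so `length p + m` stays at least `j`.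
      pursue : ∀ m H {v p x} → Subgraph H G → IsPath G (v ∷ p) → j ≤ length p + m →
               Reach H x v → (∀ {z} → Reach H x z → z ∉ p) →
               HerderCaptures H (m * (j * j + 2)) x
      pursue zero H {v} {p} _ path j≤ _ _ =
        -- With no round left, `v ∷ p` has at least `j + 1` vertices.
        contradiction (no-long-path G none (v ∷ p) path)
                      (≤⇒≯ (s≤s (subst (j ≤_) (+-identityʳ _) j≤)))
      pursue (suc m) H {v} {p} {x} H⊆G path j≤ x~v avoids =
        -- One round: `j * j` deletions for at most `j` cycles of at most `j` edges each, then two
        -- to cut off `v`.
        subst (λ n → HerderCaptures H n x) (sym (+-assoc (j * j) 2 _))
          (break-cycles j H (fewer-mono H⊆G (fewer v)) (cycle-short G none ∘ cycle-mono H⊆G)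
            λ H₁ y₁ sub₁ x~y₁ acyclic → cut-off H₁ acyclic
              λ H₂ y sub₂ y₁~y ¬y~v →
                next H₂ y (sub₁ ∘ sub₂) (x~y₁ ◅◅ Star.map sub₁ y₁~y) ¬y~v)
        where
        next : Continuation H (m * (j * j + 2)) x (λ H′ y → ¬ Reach H′ y v)
        -- The path from `v` to the cat is taken in `H`, before the deletions of this round; none is
        -- left in `H′`.
        next H′ y sub x~y ¬y~v with reach⇒move H (reach-sym H x~v ◅◅ x~y)
        ... | inj₁ refl = contradiction ε ¬y~v
        ... | inj₂ mv with first-step H mv
        ... | w , zs , v-zs , y∈ with
          -- The new target is the first vertex of this path in the cat's component of `H′`. The
          -- path stays in the cat's component of `H`, so it misses `p`.
          extend-until G H H⊆G (Reach H′ y) em (w ∷ zs) v-zs y∈ ε path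
            (λ z∈ → avoids (x~v ◅◅ linked⇒star (proj₁ v-zs) (there z∈)))
            (λ { (here refl) → ¬y~v
               ; (there z∈) y~z → avoids (x~y ◅◅ Star.map sub y~z) z∈ })
        ... | b , q , path′ , longer , y~b , outside =
          pursue m H′ (H⊆G ∘ sub) path′ bound y~b λ y~z z∈ → outside z∈ y~z
          where
          open ≤-Reasoning
          bound : j ≤ length q + m
          bound = begin
            j                  ≤⟨ j≤ ⟩
            length p + suc m   ≡⟨ +-suc _ m ⟩
            suc (length p) + m ≤⟨ +-monoˡ-≤ m longer ⟩
            length q + m       ∎

    -- Existence of the value, and the final bound.

    catNumber-exists : ∀ (G : Graph V) n → (∀ v → HerderCaptures G n v) →
                       ∃ λ c → IsCatNumber G c × c ≤ n
    catNumber-exists G zero    wins = 0 , record { guarantee = wins ; optimal = λ _ _ → z≤n } , z≤n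
    catNumber-exists G (suc n) wins with em {∀ v → HerderCaptures G n v}
    ... | yes wins′ = let c , isCat , c≤n = catNumber-exists G n wins′ in c , isCat , m≤n⇒m≤1+n c≤n
    -- A smaller guarantee would yield `n` by `weaken`, so the descent stops at the least one.
    ... | no ¬wins  = suc n , record { guarantee = wins ; optimal = minimal } , ≤-refl
      where
      minimal : ∀ m → (∀ v → HerderCaptures G m v) → suc n ≤ m
      minimal m wins′ = ≰⇒> λ m≤n → ¬wins λ v → weaken m≤n (wins′ v)

-- With `k = j + 1` the right side equals `j ^ 3 + j ^ 2 + 2 * j`, which exceeds the cost of `j`
-- rounds by `j * j`. Collecting the negative terms in a single `∸` avoids truncation.
round-bound : ∀ j → j * (j * j + 2) ≤ (suc j ^ 3 + 3 * suc j) ∸ (2 * suc j ^ 2 + 2)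
round-bound j = m+n≤o⇒m≤o∸n _ (≤-trans (m≤m+n _ (j * j)) (≤-reflexive (identity j)))
  where
  -- The powers are written out because solve-∀ fails on _^_.
  identity : ∀ j → (j * (j * j + 2) + (2 * ((1 + j) * ((1 + j) * 1)) + 2)) + j * j
                   ≡ (1 + j) * ((1 + j) * ((1 + j) * 1)) + 3 * (1 + j)
  identity = solve-∀

mainTheorem18 : (∀ {a} → ExcludedMiddle a) →
    ∀ {ℓ} {V : Set ℓ} (G : Graph V) (k : ℕ) → 1 ≤ k →
    NoPathOn k G →
    (∀ v → FewerEdgeDisjointCyclesThan k G v) →
    (∀ v → HerderCaptures G ((k ^ 3 + 3 * k) ∸ (2 * k ^ 2 + 2)) v)
    × (∃ λ c → IsCatNumber G c × c ≤ (k ^ 3 + 3 * k) ∸ (2 * k ^ 2 + 2))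
mainTheorem18 em G (suc j) _ none fewer = wins , catNumber-exists em G _ wins
  where
  wins : ∀ v → HerderCaptures G ((suc j ^ 3 + 3 * suc j) ∸ (2 * suc j ^ 2 + 2)) v
  wins v = weaken (round-bound j)
    -- The first target is the cat's own vertex and `p` is empty, so `j` rounds suffice.
    (pursue em none fewer j G id ([-] , [] ∷ []) ≤-refl ε λ _ ())
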